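{- Let $S$ be a lattice of finite length and let $(L_x)_{x\in S}$ be an $S$-glued system of lattices of finite length. - If every $L_x$ is modular, then the $S$-glued sum $L$ is modular. - If every $L_x$ is semimodular, then $L$ is semimodular.
   Context: A partially ordered set is of finite length if every chain in it is finite. Write $x\prec y$ if $y$ covers $x$. A lattice of finite length is semimodular if, whenever $a\prec b$, $a\prec c$ and $b\ne c$, we have $b\prec b+c$ and $c\prec b+c$. $S$ has order $\le$, join $\vee$ and meet $\wedge$. Each $L_x$ has order $\le_x$, join $+_x$ and meet $\cdot_x$; the underlying sets need not be disjoint. The family is an $S$-glued system if for all $x,y\in S$: (1) if $x\le y$ and $L_x\cap L_y\ne\emptyset$, then $L_x\cap L_y$ is a filter of $L_x$ and an ideal of $L_y$; (2) if $x\le y$, then for $a,b\in L_x\cap L_y$ we have $a\le_x b\iff a\le_y b$; (3) if $x\prec y$, then $L_x\cap L_y\ne\emptyset$; (4) $L_x\cap L_y\subseteq L_{x\wedge y}\cap L_{x\vee y}$. A filter is a nonempty up-closed subset closed under meets; an ideal is the dual notion. The $S$-glued sum is $L=\bigcup_x L_x$, ordered by the transitive closure of $\bigcup_x\le_x$. It is a lattice. -}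

module Defs where

open import Data.Product using (Σ; ∃; _×_; _,_)
open import Data.Sum using (_⊎_)
open import Data.Unit using (⊤)
open import Data.List using (List)
open import Data.List.Membership.Propositional using (_∈_)
open import Relation.Nullary using (¬_)
open import Relation.Binary.PropositionalEquality using (_≡_)
open import Relation.Binary.Construct.Closure.Transitive using (TransClosure)

-- A (sub)set of a type A, given as a predicate; used for the carriers
-- of the lattices L_x, which are subsets of a common universe U
-- (the underlying sets need not be disjoint).
Subset : Set → Set₁
Subset A = A → Set

Rel : Set → Set₁
Rel A = A → A → Set

Op₂ : Set → Set
Op₂ A = A → A → A

record IsLatticeOn {A : Set} (P : Subset A) (_≤_ : Rel A) (_+_ _·_ : Op₂ A) : Set where
  field
    refl    : ∀ {a} → P a → a ≤ a
    antisym : ∀ {a b} → P a → P b → a ≤ b → b ≤ a → a ≡ b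
    trans   : ∀ {a b c} → P a → P b → P c → a ≤ b → b ≤ c → a ≤ c
    +-closed : ∀ {a b} → P a → P b → P (a + b)
    ·-closed : ∀ {a b} → P a → P b → P (a · b)
    +-upperˡ : ∀ {a b} → P a → P b → a ≤ (a + b)
    +-upperʳ : ∀ {a b} → P a → P b → b ≤ (a + b)
    +-least  : ∀ {a b c} → P a → P b → P c → a ≤ c → b ≤ c → (a + b) ≤ c
    ·-lowerˡ : ∀ {a b} → P a → P b → (a · b) ≤ a
    ·-lowerʳ : ∀ {a b} → P a → P b → (a · b) ≤ b
    ·-greatest : ∀ {a b c} → P a → P b → P c → c ≤ a → c ≤ b → c ≤ (a · b)

IsChain : {A : Set} → Subset A → Rel A → Subset A → Set
IsChain P _≤_ C = (∀ {a} → C a → P a) × (∀ {a b} → C a → C b → (a ≤ b) ⊎ (b ≤ a))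

IsFinite : {A : Set} → Subset A → Set
IsFinite {A} C = Σ (List A) λ xs → ∀ {a} → C a → a ∈ xs

FiniteLength : {A : Set} → Subset A → Rel A → Set₁
FiniteLength P _≤_ = (C : Subset _) → IsChain P _≤_ C → IsFinite C

Covers : {A : Set} → Subset A → Rel A → A → A → Set
Covers P _≤_ a b =
  P a × P b × a ≤ b × ¬ (a ≡ b) ×
  (∀ {z} → P z → a ≤ z → z ≤ b → (z ≡ a) ⊎ (z ≡ b))

Modular : {A : Set} → Subset A → Rel A → Op₂ A → Op₂ A → Set
Modular P _≤_ _+_ _·_ =
  ∀ {a b c} → P a → P b → P c → a ≤ c → (a + (b · c)) ≡ ((a + b) · c)

Semimodular : {A : Set} → Subset A → Rel A → Op₂ A → Set
Semimodular P _≤_ _+_ =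
  ∀ {a b c} → Covers P _≤_ a b → Covers P _≤_ a c → ¬ (b ≡ c) →
  Covers P _≤_ b (b + c) × Covers P _≤_ c (b + c)

Whole : (A : Set) → Subset A
Whole A = λ _ → ⊤

record Family (S U : Set) : Set₁ where
  field
    car  : S → Subset U
    le   : S → Rel U
    join : S → Op₂ U
    meet : S → Op₂ U
    isLattice    : ∀ x → IsLatticeOn (car x) (le x) (join x) (meet x)
    finiteLength : ∀ x → FiniteLength (car x) (le x)

module _ {S U : Set} (_≤S_ : Rel S) (_∨_ _∧_ : Op₂ S) (F : Family S U) where
  open Family F

  Both : S → S → Subset U
  Both x y a = car x a × car y a

  IsFilter : S → Subset U → Set
  IsFilter x I = (∃ λ a → I a)
    × (∀ {a b} → I a → car x b → le x a b → I b)
    × (∀ {a b} → I a → I b → I (meet x a b))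

  IsIdeal : S → Subset U → Set
  IsIdeal y I = (∃ λ a → I a)
    × (∀ {a b} → I a → car y b → le y b a → I b)
    × (∀ {a b} → I a → I b → I (join y a b))

  record IsGluedSystem : Set where
    field
      cond1 : ∀ {x y} → x ≤S y → (∃ λ a → Both x y a) →
              IsFilter x (Both x y) × IsIdeal y (Both x y)
      cond2 : ∀ {x y} → x ≤S y → ∀ {a b} → Both x y a → Both x y b →
              (le x a b → le y a b) × (le y a b → le x a b)
      cond3 : ∀ {x y} → Covers (Whole S) _≤S_ x y → ∃ λ a → Both x y a
      cond4 : ∀ {x y a} → Both x y a → car (x ∧ y) a × car (x ∨ y) a

  GluedCarrier : Subset U
  GluedCarrier a = ∃ λ x → car x a

  Step : Rel U
  Step a b = ∃ λ x → car x a × car x b × le x a b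

  GluedOrder : Rel U
  GluedOrder = TransClosure Step

{-# OPTIONS --safe #-}

-- Write a ▷ b when a ≤ₓ b in some L_x, so that the order of L is the transitive closure of ▷.
-- If v ▷ s and v ▷ t with v, s ∈ L_x and v, t ∈ L_y, then v, s, t ∈ L_{x∨y}, because
-- L_x ∩ L_{x∨y} is a filter of L_x containing v; dually below a common upper bound.  Moreover
-- every L_x is a convex sublattice of L.  Since a covering pair of L is a ▷-pair, semimodularity
-- can be checked in a single L_x.  For modularity, let p ≤ q have the same join with b and the
-- same meet v with b.  When v ▷ b, pushing this step along a ▷-path from v to p, one modular
-- square at a time, gives q = p ∨ (q ∧ b) = p.  In general this and its dual allow an
-- induction on a ▷-path from v to b.
module Submission where

open import Defs
open import Data.Product using (Σ; ∃; _×_; _,_; proj₁; proj₂)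
open import Data.Sum using (inj₁; inj₂)
open import Data.Unit using (tt)
open import Function using (flip; _on_)
open import Level using (Level; _⊔_)
open import Relation.Binary using (_Respectsʳ_)
open import Relation.Binary.Construct.Closure.Transitive using (TransClosure; [_]; _∷_; _∷ʳ_)
open import Relation.Binary.Lattice using (Lattice)
open import Relation.Binary.PropositionalEquality using (_≡_; refl; sym; trans; cong; subst)
import Relation.Binary as B
import Relation.Binary.Lattice.Properties.JoinSemilattice as JoinProperties
import Relation.Binary.Lattice.Properties.Lattice as LatticeProperties
import Relation.Binary.Lattice.Properties.MeetSemilattice as MeetProperties

-- Modularity of a lattice whose order is generated by a step relation

private
  variable
    c ℓ₁ ℓ₂ ℓ : Level

flip⁺ : {A : Set c} {R : B.Rel A ℓ} {x y : A} → TransClosure R x y → TransClosure (flip R) y x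
flip⁺ [ r ]   = [ r ]
flip⁺ (r ∷ p) = flip⁺ p ∷ʳ r

-- Collects what the path induction needs. Instantiated at the dual lattice with `flip _▷_`, the
-- same record supplies the dual facts, so `transpose` is proved only once.
record JoinModularSteps (L : Lattice c ℓ₁ ℓ₂) (_▷_ : B.Rel (Lattice.Carrier L) ℓ) : Set (c ⊔ ℓ₁ ⊔ ℓ₂ ⊔ ℓ) where
  open Lattice L
  field
    ▷-respʳ : _▷_ Respectsʳ _≈_
    ▷⇒≤     : ∀ {x y} → x ▷ y → x ≤ y
    ≤⇒▷⁺    : ∀ {x y} → x ≤ y → TransClosure _▷_ x y
    ▷-∨     : ∀ {v s t} → v ▷ s → v ▷ t → t ▷ (t ∨ s)
    ▷-mod   : ∀ {v s t q} → v ▷ s → v ▷ t → t ≤ q → q ≤ t ∨ s → q ≤ t ∨ (q ∧ s)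

  ▷⁺⇒≤ : ∀ {x y} → TransClosure _▷_ x y → x ≤ y
  ▷⁺⇒≤ [ r ]   = ▷⇒≤ r
  ▷⁺⇒≤ (r ∷ p) = Lattice.trans L (▷⇒≤ r) (▷⁺⇒≤ p)

module Transposition (L : Lattice c ℓ₁ ℓ₂) {_▷_ : B.Rel (Lattice.Carrier L) ℓ}
                     (steps : JoinModularSteps L _▷_) where
  open Lattice L renaming (refl to ≤-refl; trans to ≤-trans)
  open JoinProperties joinSemilattice using (∨-monotonic)
  open MeetProperties meetSemilattice using (∧-monotonic)
  open JoinModularSteps steps

  -- Induction on the path: past its first step `v ▷ t`, the step `v ▷ s` becomes `t ▷ (t ∨ s)`, and
  -- `p ∧ s ≤ v` passes to the shifted step. The modular laws of the stacked squares then compose.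
  transpose : ∀ {v s p} → v ▷ s → TransClosure _▷_ v p → p ∧ s ≤ v →
              (p ▷ (p ∨ s)) × (∀ {q} → p ≤ q → q ≤ p ∨ s → q ≤ p ∨ (q ∧ s))
  transpose v▷s [ v▷p ] _ = ▷-∨ v▷s v▷p , ▷-mod v▷s v▷p
  transpose {v} {s} {p} v▷s (_∷_ {y = t} v▷t t▷⁺p) p∧s≤v =
    -- Since `t ≤ p`, joining `p` with `t ∨ s` or with `s` gives the same element up to `_≈_`.
    ▷-respʳ (antisym (∨-least (x≤x∨y p s) (∨-least (≤-trans t≤p (x≤x∨y p s)) (y≤x∨y p s)))
                     (∨-monotonic ≤-refl (y≤x∨y t s)))
            (proj₁ ih) ,
    λ {q} p≤q q≤p∨s →
      -- The induction gives `q ≤ p ∨ (q ∧ (t ∨ s))`; the first square then bounds `q ∧ (t ∨ s)` by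
      -- `t ∨ (q ∧ s)`.
      ≤-trans (proj₂ ih p≤q (≤-trans q≤p∨s (∨-monotonic ≤-refl (y≤x∨y t s))))
              (∨-least (x≤x∨y p _)
                (≤-trans (▷-mod v▷s v▷t (∧-greatest (≤-trans t≤p p≤q) (x≤x∨y t s)) (x∧y≤y q _))
                         (∨-monotonic t≤p (∧-monotonic (x∧y≤x q _) ≤-refl))))
    where
    t≤p : t ≤ p
    t≤p = ▷⁺⇒≤ t▷⁺p
    p∧[t∨s]≤t : p ∧ (t ∨ s) ≤ t
    p∧[t∨s]≤t =
      ≤-trans (▷-mod v▷s v▷t (∧-greatest t≤p (x≤x∨y t s)) (x∧y≤y p _))
              (∨-least ≤-refl (≤-trans (∧-monotonic (x∧y≤x p _) ≤-refl) (≤-trans p∧s≤v (▷⇒≤ v▷t))))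
    ih = transpose (▷-∨ v▷s v▷t) t▷⁺p p∧[t∨s]≤t

module StepModularity (L : Lattice c ℓ₁ ℓ₂) {_▷_ : B.Rel (Lattice.Carrier L) ℓ}
                      (steps : JoinModularSteps L _▷_)
                      (dualSteps : JoinModularSteps (LatticeProperties.∧-∨-lattice L) (flip _▷_)) where
  open Lattice L renaming (refl to ≤-refl; trans to ≤-trans)
  open JoinProperties joinSemilattice using (∨-monotonic)
  open MeetProperties meetSemilattice using (∧-monotonic)
  open JoinModularSteps steps
  open Transposition L steps
  module Dual = Transposition (LatticeProperties.∧-∨-lattice L) dualSteps

  -- Let `e = (q ∨ s) ∧ b`. Transposing up gives `q ▷ (q ∨ s)`; transposing this step down to `e`
  -- gives a modular law for `s`, which lies between `e ∧ q` and `e`. Hence `e ≤ e ∧ (s ∨ q) ≤ s`.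
  [q∨s]∧b≤s : ∀ {v s q b} → v ▷ s → s ≤ b → v ≤ q → q ∧ b ≤ v → (q ∨ s) ∧ b ≤ s
  [q∨s]∧b≤s {v} {s} {q} {b} v▷s s≤b v≤q q∧b≤v =
    ≤-trans (∧-greatest ≤-refl (≤-trans (x∧y≤x _ b) (∨-least (y≤x∨y s q) (x≤x∨y s q))))
            (proj₂ (Dual.transpose q▷q∨s (JoinModularSteps.≤⇒▷⁺ dualSteps (x∧y≤x _ b)) q∨s≤e∨q)
                   s≤e
                   (≤-trans (∧-greatest (x∧y≤y _ q) (≤-trans (x∧y≤x _ q) (x∧y≤y _ b)))
                            (≤-trans q∧b≤v (▷⇒≤ v▷s))))
    where
    s≤e : s ≤ (q ∨ s) ∧ b
    s≤e = ∧-greatest (y≤x∨y q s) s≤b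
    q▷q∨s : q ▷ (q ∨ s)
    q▷q∨s = proj₁ (transpose v▷s (≤⇒▷⁺ v≤q) (≤-trans (∧-monotonic ≤-refl s≤b) q∧b≤v))
    q∨s≤e∨q : q ∨ s ≤ ((q ∨ s) ∧ b) ∨ q
    q∨s≤e∨q = ∨-least (y≤x∨y _ q) (≤-trans s≤e (x≤x∨y _ q))

  cancel-step : ∀ {v s p q} → v ▷ s → v ≤ p → p ≤ q → q ≤ p ∨ s → q ∧ s ≤ v → q ≤ p
  cancel-step v▷s v≤p p≤q q≤p∨s q∧s≤v =
    ≤-trans (proj₂ (transpose v▷s (≤⇒▷⁺ v≤p) (≤-trans (∧-monotonic p≤q ≤-refl) q∧s≤v)) p≤q q≤p∨s)
            (∨-least ≤-refl (≤-trans q∧s≤v v≤p))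

  -- The tail of the path compares `p ∨ s` with `q ∨ s` over the new base `s`, where `[q∨s]∧b≤s`
  -- restores the meet condition. This yields `q ≤ p ∨ s`, and `cancel-step` handles the first step.
  cancel : ∀ {v b p q} → TransClosure _▷_ v b → v ≤ p → p ≤ q → q ≤ p ∨ b → q ∧ b ≤ v → q ≤ p
  cancel [ v▷b ] v≤p p≤q q≤p∨b q∧b≤v = cancel-step v▷b v≤p p≤q q≤p∨b q∧b≤v
  cancel {v} {b} {p} {q} (_∷_ {y = s} v▷s s▷⁺b) v≤p p≤q q≤p∨b q∧b≤v =
    cancel-step v▷s v≤p p≤q (≤-trans (x≤x∨y q s) q∨s≤p∨s)
                (≤-trans (∧-monotonic ≤-refl s≤b) q∧b≤v)
    where
    s≤b : s ≤ b
    s≤b = ▷⁺⇒≤ s▷⁺b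
    q∨s≤p∨s : q ∨ s ≤ p ∨ s
    q∨s≤p∨s = cancel s▷⁺b (y≤x∨y p s) (∨-monotonic p≤q ≤-refl)
      (∨-least (≤-trans q≤p∨b (∨-monotonic (x≤x∨y p s) ≤-refl)) (≤-trans (y≤x∨y p s) (x≤x∨y _ b)))
      ([q∨s]∧b≤s v▷s s≤b (≤-trans v≤p p≤q) q∧b≤v)

  modular : ∀ {a b c} → a ≤ c → a ∨ (b ∧ c) ≈ (a ∨ b) ∧ c
  modular {a} {b} {c} a≤c = antisym
    p≤q
    -- Both sides have the join `a ∨ b` and the meet `b ∧ c` with `b`, so the path runs from `b ∧ c`
    -- to `b`.
    (cancel (≤⇒▷⁺ (x∧y≤x b c)) (y≤x∨y a _) p≤q
      (≤-trans (x∧y≤x _ c) (∨-monotonic (x≤x∨y a _) ≤-refl))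
      (∧-greatest (x∧y≤y _ b) (≤-trans (x∧y≤x _ b) (x∧y≤y _ c))))
    where
    p≤q : a ∨ (b ∧ c) ≤ (a ∨ b) ∧ c
    p≤q = ∨-least (∧-greatest (x≤x∨y a b) a≤c) (∧-monotonic (y≤x∨y a b) ≤-refl)

-- Membership proofs need not be unique, so elements are compared by their first components only.
latticeOn : {A : Set} {P : Subset A} {_≤_ : Rel A} {_+_ _·_ : Op₂ A} →
            IsLatticeOn P _≤_ _+_ _·_ → Lattice _ _ _
latticeOn {A} {P} {_≤_} {_+_} {_·_} isL = record
  { Carrier   = Σ A P
  ; _≈_       = _≡_ on proj₁
  ; _≤_       = _≤_ on proj₁
  ; _∨_       = λ (a , pa) (b , pb) → a + b , +-closed pa pb
  ; _∧_       = λ (a , pa) (b , pb) → a · b , ·-closed pa pb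
  ; isLattice = record
    { isPartialOrder = record
      { isPreorder = record
        { isEquivalence = record { refl = refl ; sym = sym ; trans = trans }
        ; reflexive     = λ { {_ , pa} refl → ≤-refl pa }
        ; trans         = λ { {_ , pa} {_ , pb} {_ , pc} → ≤-trans pa pb pc }
        }
      ; antisym = λ { {_ , pa} {_ , pb} → antisym pa pb }
      }
    ; supremum = λ (_ , pa) (_ , pb) → +-upperˡ pa pb , +-upperʳ pa pb , λ (_ , pc) → +-least pa pb pc
    ; infimum  = λ (_ , pa) (_ , pb) → ·-lowerˡ pa pb , ·-lowerʳ pa pb , λ (_ , pc) → ·-greatest pa pb pc
    }
  }
  where open IsLatticeOn isL renaming (refl to ≤-refl; trans to ≤-trans)

-- Each lattice of the family as a convex sublattice of the glued sum

module GluedSum (S U : Set) (_≤S_ : Rel S) (_∨_ _∧_ : Op₂ S)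
                (isS : IsLatticeOn (Whole S) _≤S_ _∨_ _∧_)
                (F : Family S U) (glued : IsGluedSystem _≤S_ _∨_ _∧_ F)
                (_⊔_ _⊓_ : Op₂ U)
                (isL : IsLatticeOn (GluedCarrier _≤S_ _∨_ _∧_ F) (GluedOrder _≤S_ _∨_ _∧_ F) _⊔_ _⊓_) where
  open Family F
  open IsGluedSystem glued
  private
    module S = IsLatticeOn isS
    module L = IsLatticeOn isL
    module At x = IsLatticeOn (isLattice x)

  _▷_ : Rel U
  _▷_ = Step _≤S_ _∨_ _∧_ F

  _≤_ : Rel U
  _≤_ = GluedOrder _≤S_ _∨_ _∧_ F

  P : Subset U
  P = GluedCarrier _≤S_ _∨_ _∧_ F

  embed : ∀ {z a b} → car z a → car z b → le z a b → a ≤ b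
  embed za zb a≤b = [ _ , za , zb , a≤b ]

  raise : ∀ {x w a b} → x ≤S w → car w a → car x a → car x b → le x a b → car w b × le w a b
  raise x≤w wa xa xb a≤b = proj₂ xb×wb , proj₁ (cond2 x≤w (xa , wa) xb×wb) a≤b
    where
    xb×wb = proj₁ (proj₂ (proj₁ (cond1 x≤w (_ , xa , wa)))) (xa , wa) xb a≤b

  lower : ∀ {x w a b} → w ≤S x → car w b → car x a → car x b → le x a b → car w a
  lower w≤x wb xa xb a≤b =
    proj₁ (proj₁ (proj₂ (proj₂ (cond1 w≤x (_ , wb , xb)))) (wb , xb) xa a≤b)

  raise-step : ∀ {z x a b} → car z a → car x a → car x b → le x a b →
               car (z ∨ x) a × car (z ∨ x) b × le (z ∨ x) a b
  raise-step za xa xb a≤b = wa , raise (S.+-upperʳ tt tt) wa xa xb a≤b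
    where wa = proj₂ (cond4 (za , xa))

  -- A step taken in `L_x` is lifted from the current index to its join with `x`, so the index only
  -- grows.
  ascend : ∀ {z a t} → car z a → a ≤ t → ∃ λ w → z ≤S w × car w t
  ascend za [ x , xa , xt , a≤t ] =
    _ , S.+-upperˡ tt tt , proj₁ (proj₂ (raise-step za xa xt a≤t))
  ascend za ((x , xa , xs , a≤s) ∷ s≤t) with raise-step za xa xs a≤s
  ... | _ , ws , _ with ascend ws s≤t
  ...   | u , w≤u , ut = u , S.trans tt tt tt (S.+-upperˡ tt tt) w≤u , ut

  -- The upper index `w` is generalised because a step may leave `L_w`; it is then raised to
  -- `w ∨ x`, still above `z`. Membership in `L_z` comes back down from `b` by the ideal condition.
  descend : ∀ {z w a b} → z ≤S w → car w a → a ≤ b → car z b → car z a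
  descend z≤w wa [ x , xa , xb , a≤b ] zb with raise-step wa xa xb a≤b
  ... | ua , ub , a≤ᵤb = lower (S.trans tt tt tt z≤w (S.+-upperˡ tt tt)) zb ua ub a≤ᵤb
  descend z≤w wa ((x , xa , xt , a≤t) ∷ t≤b) zb with raise-step wa xa xt a≤t
  ... | ua , ut , a≤ᵤt = lower z≤u (descend z≤u ut t≤b zb) ua ut a≤ᵤt
    where z≤u = S.trans tt tt tt z≤w (S.+-upperˡ tt tt)

  convex : ∀ {z a t b} → car z a → car z b → a ≤ t → t ≤ b → car z t
  convex za zb a≤t t≤b with ascend za a≤t
  ... | _ , z≤w , wt = descend z≤w wt t≤b zb

  -- Convexity keeps the whole path inside `L_z`; a single step from `L_x` is compared with `L_z`
  -- through their common lift at `z ∨ x`.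
  restrict : ∀ {z a b} → car z a → car z b → a ≤ b → le z a b
  restrict {z} za zb [ x , xa , xb , a≤b ] with raise-step za xa xb a≤b
  ... | wa , wb , a≤ᵥb = proj₂ (cond2 (S.+-upperˡ tt tt) (za , wa) (zb , wb)) a≤ᵥb
  restrict {z} za zb ((x , xa , xt , a≤t) ∷ t≤b) =
    At.trans z za zt zb (restrict za zt [ x , xa , xt , a≤t ]) (restrict zt zb t≤b)
    where
    zt = convex za zb [ x , xa , xt , a≤t ] t≤b

  -- `a ⊔ b` lies between `a` and `join z a b`, both in `L_z`.
  ⊔-mem : ∀ {z a b} → car z a → car z b → car z (a ⊔ b)
  ⊔-mem {z} za zb = convex za zj (L.+-upperˡ (z , za) (z , zb))
    (L.+-least (z , za) (z , zb) (z , zj) (embed za zj (At.+-upperˡ z za zb)) (embed zb zj (At.+-upperʳ z za zb)))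
    where zj = At.+-closed z za zb

  ⊓-mem : ∀ {z a b} → car z a → car z b → car z (a ⊓ b)
  ⊓-mem {z} za zb = convex zm za
    (L.·-greatest (z , za) (z , zb) (z , zm) (embed zm za (At.·-lowerˡ z za zb)) (embed zm zb (At.·-lowerʳ z za zb)))
    (L.·-lowerˡ (z , za) (z , zb))
    where zm = At.·-closed z za zb

  ⊔≡join : ∀ {z a b} → car z a → car z b → a ⊔ b ≡ join z a b
  ⊔≡join {z} za zb = L.antisym (z , ⊔-mem za zb) (z , zj)
    (L.+-least (z , za) (z , zb) (z , zj) (embed za zj (At.+-upperˡ z za zb)) (embed zb zj (At.+-upperʳ z za zb)))
    (embed zj (⊔-mem za zb) (At.+-least z za zb (⊔-mem za zb)
      (restrict za (⊔-mem za zb) (L.+-upperˡ (z , za) (z , zb)))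
      (restrict zb (⊔-mem za zb) (L.+-upperʳ (z , za) (z , zb)))))
    where zj = At.+-closed z za zb

  ⊓≡meet : ∀ {z a b} → car z a → car z b → a ⊓ b ≡ meet z a b
  ⊓≡meet {z} za zb = L.antisym (z , ⊓-mem za zb) (z , zm)
    (embed (⊓-mem za zb) zm (At.·-greatest z za zb (⊓-mem za zb)
      (restrict (⊓-mem za zb) za (L.·-lowerˡ (z , za) (z , zb)))
      (restrict (⊓-mem za zb) zb (L.·-lowerʳ (z , za) (z , zb)))))
    (L.·-greatest (z , za) (z , zb) (z , zm) (embed zm za (At.·-lowerˡ z za zb)) (embed zm zb (At.·-lowerʳ z za zb)))
    where zm = At.·-closed z za zb

  -- Steps sharing an endpoint, covers and semimodularity

  common-above : ∀ {v s t} → v ▷ s → v ▷ t → ∃ λ z → car z v × car z s × car z t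
  common-above (x , xv , xs , v≤s) (y , yv , yt , v≤t) =
    x ∨ y , zv , proj₁ (raise (S.+-upperˡ tt tt) zv xv xs v≤s) , proj₁ (raise (S.+-upperʳ tt tt) zv yv yt v≤t)
    where zv = proj₂ (cond4 (xv , yv))

  common-below : ∀ {v s t} → s ▷ v → t ▷ v → ∃ λ z → car z v × car z s × car z t
  common-below (x , xs , xv , s≤v) (y , yt , yv , t≤v) =
    x ∧ y , zv , lower (S.·-lowerˡ tt tt) zv xs xv s≤v , lower (S.·-lowerʳ tt tt) zv yt yv t≤v
    where zv = proj₁ (cond4 (xv , yv))

  cover⇒▷ : ∀ {a b} → Covers P _≤_ a b → a ▷ b
  cover⇒▷ {a} {b} (_ , _ , a≤b , _ , between) = go a≤b
    where
    go : a ≤ b → a ▷ b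
    go [ a▷b ] = a▷b
    go (a▷t@(x , _ , xt , _) ∷ t≤b) with between (x , xt) [ a▷t ] t≤b
    -- Steps may be trivial, as each `le x` is reflexive; such a step is dropped.
    ... | inj₁ refl = go t≤b
    ... | inj₂ refl = a▷t

  cover-restrict : ∀ {z a b} → car z a → car z b → Covers P _≤_ a b → Covers (car z) (le z) a b
  cover-restrict za zb (_ , _ , a≤b , a≢b , between) =
    za , zb , restrict za zb a≤b , a≢b ,
    λ zt a≤t t≤b → between (_ , zt) (embed za zt a≤t) (embed zt zb t≤b)

  cover-embed : ∀ {z a b} → Covers (car z) (le z) a b → Covers P _≤_ a b
  cover-embed (za , zb , a≤b , a≢b , between) =
    (_ , za) , (_ , zb) , embed za zb a≤b , a≢b ,
    λ _ a≤t t≤b → let zt = convex za zb a≤t t≤b in between zt (restrict za zt a≤t) (restrict zt zb t≤b)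

  semimodular : (∀ x → Semimodular (car x) (le x) (join x)) → Semimodular P _≤_ _⊔_
  semimodular locally a≺b a≺c b≢c with common-above (cover⇒▷ a≺b) (cover⇒▷ a≺c)
  ... | z , za , zb , zc
    with locally z (cover-restrict za zb a≺b) (cover-restrict za zc a≺c) b≢c
  ...   | b≺b+c , c≺b+c rewrite ⊔≡join zb zc = cover-embed b≺b+c , cover-embed c≺b+c

  -- Modularity of the glued sum

  𝕃 : Lattice _ _ _
  𝕃 = latticeOn isL

  ⊓-comm : ∀ {a b} → P a → P b → a ⊓ b ≡ b ⊓ a
  ⊓-comm pa pb = MeetProperties.∧-comm (Lattice.meetSemilattice 𝕃) (_ , pa) (_ , pb)

  -- Elements of `𝕃` carry membership proofs; each intermediate point takes its proof from the step
  -- reaching it.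
  ≤⇒▷⁺ : ∀ {a b} (pa : P a) (pb : P b) → a ≤ b → TransClosure (_▷_ on proj₁) (a , pa) (b , pb)
  ≤⇒▷⁺ _ _  [ a▷b ] = [ a▷b ]
  ≤⇒▷⁺ _ pb (a▷t@(x , _ , xt , _) ∷ t≤b) = a▷t ∷ ≤⇒▷⁺ (x , xt) pb t≤b

  module _ (locally : ∀ x → Modular (car x) (le x) (join x) (meet x)) where

    modular-in : ∀ {z a b c} → car z a → car z b → car z c → a ≤ c → a ⊔ (b ⊓ c) ≡ (a ⊔ b) ⊓ c
    modular-in {z} {a} {b} {c} za zb zc a≤c
      rewrite ⊔≡join za (⊓-mem zb zc) | ⊓≡meet zb zc | ⊓≡meet (⊔-mem za zb) zc | ⊔≡join za zb =
      locally z za zb zc (restrict za zc a≤c)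

    upper-square : ∀ {z s t q} → car z s → car z t → car z q → t ≤ q → q ≤ (t ⊔ s) → q ≤ (t ⊔ (q ⊓ s))
    upper-square {z} {s} {t} {q} zs zt zq t≤q q≤t⊔s =
      subst (q ≤_)
        (trans (sym (modular-in zt zs zq t≤q)) (cong (t ⊔_) (⊓-comm (z , zs) (z , zq))))
        (L.·-greatest (z , ⊔-mem zt zs) (z , zq) (z , zq) q≤t⊔s (L.refl (z , zq)))

    -- Modularity is self-dual: the same local law serves, now with `q` as the smaller element of
    -- the pair `q ≤ t`.
    lower-square : ∀ {z s t q} → car z s → car z t → car z q → q ≤ t → (t ⊓ s) ≤ q → (t ⊓ (q ⊔ s)) ≤ q
    lower-square {z} {s} {t} {q} zs zt zq q≤t t⊓s≤q =
      subst (_≤ q)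
        (trans (cong (q ⊔_) (⊓-comm (z , zt) (z , zs)))
          (trans (modular-in zq zs zt q≤t) (⊓-comm (z , ⊔-mem zq zs) (z , zt))))
        (L.+-least (z , zq) (z , ⊓-mem zt zs) (z , zq) (L.refl (z , zq)) t⊓s≤q)

    joinSteps : JoinModularSteps 𝕃 (_▷_ on proj₁)
    joinSteps = record
      { ▷-respʳ = λ { refl r → r }
      ; ▷⇒≤     = [_]
      ; ≤⇒▷⁺    = λ {a} {b} → ≤⇒▷⁺ (proj₂ a) (proj₂ b)
      ; ▷-∨     = λ {_} {s} {t} v▷s v▷t → let (z , _ , zs , zt) = common-above v▷s v▷t in
          z , zt , ⊔-mem zt zs , restrict zt (⊔-mem zt zs) (L.+-upperˡ (proj₂ t) (proj₂ s))
      ; ▷-mod   = λ v▷s v▷t t≤q q≤t⊔s → let (z , _ , zs , zt) = common-above v▷s v▷t in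
          -- `q` is any element of `L`; its position between `t` and `t ⊔ s` puts it in `L_z` by
          -- convexity.
          upper-square zs zt (convex zt (⊔-mem zt zs) t≤q q≤t⊔s) t≤q q≤t⊔s
      }

    meetSteps : JoinModularSteps (LatticeProperties.∧-∨-lattice 𝕃) (flip (_▷_ on proj₁))
    meetSteps = record
      { ▷-respʳ = λ { refl r → r }
      ; ▷⇒≤     = [_]
      ; ≤⇒▷⁺    = λ {a} {b} b≤a → flip⁺ (≤⇒▷⁺ (proj₂ b) (proj₂ a) b≤a)
      ; ▷-∨     = λ {_} {s} {t} s▷v t▷v → let (z , _ , zs , zt) = common-below s▷v t▷v in
          z , ⊓-mem zt zs , zt , restrict (⊓-mem zt zs) zt (L.·-lowerˡ (proj₂ t) (proj₂ s))
      ; ▷-mod   = λ s▷v t▷v q≤t t⊓s≤q → let (z , _ , zs , zt) = common-below s▷v t▷v in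
          lower-square zs zt (convex (⊓-mem zt zs) zt t⊓s≤q q≤t) q≤t t⊓s≤q
      }

    modular : Modular P _≤_ _⊔_ _⊓_
    modular pa pb pc = StepModularity.modular 𝕃 joinSteps meetSteps {_ , pa} {_ , pb} {_ , pc}

theorem3p2 : (S U : Set) (_≤S_ : Rel S) (_∨_ _∧_ : Op₂ S)
    → IsLatticeOn (Whole S) _≤S_ _∨_ _∧_
    → FiniteLength (Whole S) _≤S_
    → (F : Family S U)
    → IsGluedSystem _≤S_ _∨_ _∧_ F
    → (_⊔_ _⊓_ : Op₂ U)
    → IsLatticeOn (GluedCarrier _≤S_ _∨_ _∧_ F) (GluedOrder _≤S_ _∨_ _∧_ F) _⊔_ _⊓_
    → ((∀ x → Modular (Family.car F x) (Family.le F x) (Family.join F x) (Family.meet F x))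
    → Modular (GluedCarrier _≤S_ _∨_ _∧_ F) (GluedOrder _≤S_ _∨_ _∧_ F) _⊔_ _⊓_)
    × ((∀ x → Semimodular (Family.car F x) (Family.le F x) (Family.join F x))
    → Semimodular (GluedCarrier _≤S_ _∨_ _∧_ F) (GluedOrder _≤S_ _∨_ _∧_ F) _⊔_)
theorem3p2 S U _≤S_ _∨_ _∧_ isS _ F glued _⊔_ _⊓_ isL = modular , semimodular
  where open GluedSum S U _≤S_ _∨_ _∧_ isS F glued _⊔_ _⊓_ isL
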